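{- Let $n\ge 1$ and $k$ be integers with $\lfloor n/2\rfloor \le k\le \lfloor (2n-2)/3\rfloor$. Then $$|V(\Phi^n_k)|=\binom{n-k-1}{2n-3k-2}$$ and $$|E(\Phi^n_k)|=|E(\Phi^{n-2}_{k-1})|+|E(\Phi^{n-3}_{k-2})|+|V(\Phi^{n-5}_{k-3})|.$$
   Context: A subword of a word is a block of consecutive letters. A binary word (over $\{0,1\}$) of length $n\ge 1$ is Padovan if it starts and ends with $0$, contains no subword $00$, and contains no subword $111$. For $n\ge1$ and $\lfloor n/2\rfloor\le k\le\lfloor(2n-2)/3\rfloor$, the weighted Padovan graph $\Phi^n_k$ is the simple graph whose vertices are all Padovan words of length $n$ with exactly $k$ letters $1$; two vertices are adjacent if one can be obtained from the other by replacing exactly one subword $01$ with $10$. Convention: for all other integer pairs $(n,k)$ (i.e. $n\le 0$, or $k$ outside the indicated range), $\Phi^n_k$ is the empty graph, with no vertices and no edges. -}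

module Defs where

open import Data.Bool.Base using (Bool; false; true)
import Data.Bool.Properties as Bool
open import Data.Empty using (⊥)
open import Data.Integer.Base as ℤ using (ℤ; +_; -[1+_]; 1ℤ; _≤_; _-_; _*_; _/_)
import Data.Integer.Properties as ℤ
open import Data.List.Base
  using (List; []; _∷_; _++_; [_]; map; filter; length)
open import Data.List.Membership.Propositional using (_∈_)
open import Data.List.Membership.Propositional.Properties
  using (∈-map⁺; ∈-map⁻; ∈-++⁺ˡ; ∈-++⁺ʳ; ∈-filter⁺; ∈-filter⁻)
open import Data.List.Properties using (++-cancelˡ; ∷-injectiveʳ; ≡-dec)
open import Data.List.Relation.Binary.Infix.Heterogeneous using (Infix)
open import Data.List.Relation.Binary.Infix.Heterogeneous.Properties using (infix?)
open import Data.List.Relation.Binary.Prefix.Heterogeneous using (Prefix)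
open import Data.List.Relation.Binary.Prefix.Heterogeneous.Properties using (prefix?)
open import Data.List.Relation.Binary.Suffix.Heterogeneous using (Suffix)
open import Data.List.Relation.Binary.Suffix.Heterogeneous.Properties using (suffix?)
open import Data.List.Relation.Unary.All as All using ()
open import Data.List.Relation.Unary.AllPairs as AllPairs using ()
open import Data.List.Relation.Unary.Any using (here)
open import Data.List.Relation.Unary.Unique.Propositional using (Unique)
import Data.List.Relation.Unary.Unique.Propositional.Properties as Unique
open import Data.Nat.Base using (ℕ; zero; suc)
open import Data.Nat.Combinatorics using (_C_)
open import Data.Product.Base using (∃; ∃₂; _×_; _,_; proj₂; uncurry)
open import Data.Sum.Base using (_⊎_; inj₁; inj₂; swap)
open import Function.Bundles using (_⇔_; mk⇔)
open import Level using (0ℓ)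
open import Relation.Binary.Core using (Rel)
open import Relation.Binary.Definitions using (Symmetric; Irreflexive; Decidable)
open import Relation.Binary.PropositionalEquality.Core using (_≡_; refl; sym; trans; cong)
open import Relation.Nullary.Decidable using (Dec; yes; no; _×-dec_; _⊎-dec_; ¬?)
open import Relation.Nullary.Negation using (¬_)
open import Relation.Unary as Pred using (Pred)

-- Vertices are the elements of A satisfying IsVertex, listed without repetition.
-- _∼_ is defined on all of A; only its restriction to vertices belongs to the graph.
record FiniteSimpleGraph (A : Set) : Set₁ where
  field
    IsVertex   : Pred A 0ℓ
    _∼_        : Rel A 0ℓ
    _∼?_       : Decidable _∼_
    ∼-sym      : Symmetric _∼_
    ∼-irrefl   : Irreflexive _≡_ _∼_
    vertices   : List A
    unique     : Unique vertices
    ∈-vertices : ∀ x → x ∈ vertices ⇔ IsVertex x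

-- For a repetition-free list, one ordered representative (the earlier element
-- first) of each two-element subset.
pairs : {A : Set} → List A → List (A × A)
pairs []       = []
pairs (x ∷ xs) = map (x ,_) xs ++ pairs xs

module _ {A : Set} (G : FiniteSimpleGraph A) where
  open FiniteSimpleGraph G

  edges : List (A × A)
  edges = filter (uncurry _∼?_) (pairs vertices)

  ∣V_∣ : ℕ
  ∣V_∣ = length vertices

  ∣E_∣ : ℕ
  ∣E_∣ = length edges

pattern 𝟎 = false
pattern 𝟏 = true

Word : Set
Word = List Bool

#𝟏 : Word → ℕ
#𝟏 w = length (filter (Bool._≟ 𝟏) w)

record IsPadovan (w : Word) : Set where
  constructor padovan
  field
    starts-with-𝟎 : Prefix _≡_ [ 𝟎 ] w
    ends-with-𝟎   : Suffix _≡_ [ 𝟎 ] w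
    no-𝟎𝟎         : ¬ Infix _≡_ (𝟎 ∷ 𝟎 ∷ []) w
    no-𝟏𝟏𝟏        : ¬ Infix _≡_ (𝟏 ∷ 𝟏 ∷ 𝟏 ∷ []) w

isPadovan? : Pred.Decidable IsPadovan
isPadovan? w with prefix? Bool._≟_ [ 𝟎 ] w
                ×-dec suffix? Bool._≟_ [ 𝟎 ] w
                ×-dec ¬? (infix? Bool._≟_ (𝟎 ∷ 𝟎 ∷ []) w)
                ×-dec ¬? (infix? Bool._≟_ (𝟏 ∷ 𝟏 ∷ 𝟏 ∷ []) w)
... | yes (s , e , a , b) = yes (padovan s e a b)
... | no ¬p = no λ where (padovan s e a b) → ¬p (s , e , a , b)

_⟶_ : Rel Word 0ℓ
x ⟶ y = ∃₂ λ u v → x ≡ u ++ 𝟎 ∷ 𝟏 ∷ v × y ≡ u ++ 𝟏 ∷ 𝟎 ∷ v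

⟶-∷ : ∀ a {x y} → x ⟶ y → (a ∷ x) ⟶ (a ∷ y)
⟶-∷ a (u , v , p , q) = a ∷ u , v , cong (a ∷_) p , cong (a ∷_) q

⟶-∷⁻ : ∀ {a x y} → (a ∷ x) ⟶ (a ∷ y) → x ⟶ y
⟶-∷⁻ ([] , v , refl , ())
⟶-∷⁻ (_ ∷ u , v , p , q) = u , v , ∷-injectiveʳ p , ∷-injectiveʳ q

_⟶?_ : Decidable _⟶_
[] ⟶? y = no λ where
  ([] , _ , () , _)
  (_ ∷ _ , _ , () , _)
(_ ∷ _) ⟶? [] = no λ where
  ([] , _ , _ , ())
  (_ ∷ _ , _ , _ , ())
(𝟎 ∷ x) ⟶? (𝟎 ∷ y) with x ⟶? y
... | yes p = yes (⟶-∷ 𝟎 p)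
... | no ¬p = no λ p → ¬p (⟶-∷⁻ p)
(𝟏 ∷ x) ⟶? (𝟏 ∷ y) with x ⟶? y
... | yes p = yes (⟶-∷ 𝟏 p)
... | no ¬p = no λ p → ¬p (⟶-∷⁻ p)
(𝟏 ∷ x) ⟶? (𝟎 ∷ y) = no λ where
  ([] , _ , () , _)
  (𝟎 ∷ _ , _ , () , _)
  (𝟏 ∷ _ , _ , _ , ())
(𝟎 ∷ []) ⟶? (𝟏 ∷ y) = no λ where
  ([] , _ , () , _)
  (𝟎 ∷ _ , _ , _ , ())
  (𝟏 ∷ _ , _ , () , _)
(𝟎 ∷ 𝟎 ∷ x) ⟶? (𝟏 ∷ y) = no λ where
  ([] , _ , () , _)
  (𝟎 ∷ _ , _ , _ , ())
  (𝟏 ∷ _ , _ , () , _)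
(𝟎 ∷ 𝟏 ∷ x) ⟶? (𝟏 ∷ y) with ≡-dec Bool._≟_ y (𝟎 ∷ x)
... | yes refl = yes ([] , x , refl , refl)
... | no y≢ = no λ where
  ([] , _ , refl , refl) → y≢ refl
  (𝟎 ∷ _ , _ , _ , ())
  (𝟏 ∷ _ , _ , () , _)

_↔₀₁_ : Rel Word 0ℓ
x ↔₀₁ y = x ⟶ y ⊎ y ⟶ x

⟶-irrefl : Irreflexive _≡_ _⟶_
⟶-irrefl refl (u , v , p , q) with () ← ++-cancelˡ u _ _ (trans (sym p) q)

↔₀₁-irrefl : Irreflexive _≡_ _↔₀₁_
↔₀₁-irrefl e (inj₁ p) = ⟶-irrefl e p
↔₀₁-irrefl e (inj₂ p) = ⟶-irrefl (sym e) p

words : ℕ → List Word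
words zero    = [ [] ]
words (suc n) = map (𝟎 ∷_) (words n) ++ map (𝟏 ∷_) (words n)

∈-words : ∀ w → w ∈ words (length w)
∈-words []      = here refl
∈-words (𝟎 ∷ w) = ∈-++⁺ˡ (∈-map⁺ (𝟎 ∷_) (∈-words w))
∈-words (𝟏 ∷ w) = ∈-++⁺ʳ _ (∈-map⁺ (𝟏 ∷_) (∈-words w))

words-unique : ∀ n → Unique (words n)
words-unique zero    = All.[] AllPairs.∷ AllPairs.[]
words-unique (suc n) = Unique.++⁺
  (Unique.map⁺ ∷-injectiveʳ (words-unique n))
  (Unique.map⁺ ∷-injectiveʳ (words-unique n))
  λ (p , q) → disjoint (∈-map⁻ (𝟎 ∷_) p) (∈-map⁻ (𝟏 ∷_) q)
  where
  disjoint : ∀ {w : Word} → (∃ λ x → x ∈ words n × w ≡ 𝟎 ∷ x) →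
             (∃ λ x → x ∈ words n × w ≡ 𝟏 ∷ x) → ⊥
  disjoint (_ , _ , refl) (_ , _ , ())

-- On ℤ, _/_ by a positive divisor rounds down.
record InRange (n k : ℤ) : Set where
  constructor inRange
  field
    1≤n   : 1ℤ ≤ n
    lower : n / + 2 ≤ k
    upper : k ≤ (+ 2 * n - + 2) / + 3

inRange? : ∀ n k → Dec (InRange n k)
inRange? n k with 1ℤ ℤ.≤? n ×-dec n / + 2 ℤ.≤? k ×-dec k ℤ.≤? (+ 2 * n - + 2) / + 3
... | yes (p , q , r) = yes (inRange p q r)
... | no ¬p = no λ where (inRange p q r) → ¬p (p , q , r)

-- The condition InRange n k makes the graph empty for all other pairs.
record IsΦVertex (n k : ℤ) (w : Word) : Set where
  constructor φVertex
  field
    in-range   : InRange n k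
    length≡n   : + length w ≡ n
    is-padovan : IsPadovan w
    #𝟏≡k       : + #𝟏 w ≡ k

isΦVertex? : ∀ n k → Pred.Decidable (IsΦVertex n k)
isΦVertex? n k w with inRange? n k ×-dec (+ length w ℤ.≟ n)
                    ×-dec isPadovan? w ×-dec (+ #𝟏 w ℤ.≟ k)
... | yes (p , q , r , s) = yes (φVertex p q r s)
... | no ¬p = no λ where (φVertex p q r s) → ¬p (p , q , r , s)

Φ : ℤ → ℤ → FiniteSimpleGraph Word
Φ n k = record
  { IsVertex   = IsΦVertex n k
  ; _∼_        = _↔₀₁_
  ; _∼?_       = λ x y → (x ⟶? y) ⊎-dec (y ⟶? x)
  ; ∼-sym      = swap
  ; ∼-irrefl   = ↔₀₁-irrefl
  ; vertices   = filter (isΦVertex? n k) (words ℤ.∣ n ∣)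
  ; unique     = Unique.filter⁺ (isΦVertex? n k) (words-unique ℤ.∣ n ∣)
  ; ∈-vertices = λ w → mk⇔
      (λ w∈ → proj₂ (∈-filter⁻ (isΦVertex? n k) {xs = words ℤ.∣ n ∣} w∈))
      (λ φ → ∈-filter⁺ (isΦVertex? n k) (listed φ) φ)
  }
  where
  listed : ∀ {w} → IsΦVertex n k w → w ∈ words ℤ.∣ n ∣
  listed {w} (φVertex _ refl _ _) = ∈-words w

-- Zero when either argument is negative.
_choose_ : ℤ → ℤ → ℕ
(+ m)    choose (+ j)    = m C j
(+ _)    choose -[1+ _ ] = 0
-[1+ _ ] choose _        = 0

infix 8 _choose_

{-# OPTIONS --safe #-}
module Submission where

-- A Padovan word is 0 followed by a sequence of blocks 10 and 110; length n and k ones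
-- force a = 2n - 3k - 2 blocks 10 and b = 2k - n + 1 blocks 110, and the range of k says
-- exactly that a and b are nonnegative.  Hence there are C(a + b, a) words, by Pascal's
-- rule on the first block.  A move 01 → 10 between Padovan words exchanges consecutive
-- blocks 10, 110.  Orienting each edge by its move, the edge either lies behind a common
-- first block 10 or 110, or exchanges the first two blocks in front of an arbitrary word.

open import Defs
open import Data.Bool.Base using (Bool)
import Data.Bool.Properties as Bool
open import Data.Empty using (⊥-elim)
open import Data.Integer.Base using (ℤ; +_; 0ℤ; 1ℤ; _≤_; _<_; _-_; _*_; _/_; _+_; +≤+)
import Data.Integer.Base as ℤ
import Data.Integer.DivMod as ℤ
import Data.Integer.Properties as ℤ
open import Data.Integer.Tactic.RingSolver using (solve-∀)
open import Data.List.Base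
  using (List; []; _∷_; _++_; [_]; map; filter; length; cartesianProduct)
open import Data.List.Membership.Propositional using (_∈_)
open import Data.List.Membership.Propositional.Properties
  using ( ∈-map⁺; ∈-map⁻; ∈-++⁺ˡ; ∈-++⁺ʳ; ∈-++⁻; ∈-filter⁺; ∈-filter⁻
        ; ∈-cartesianProduct⁺; ∈-cartesianProduct⁻ )
open import Data.List.Membership.Propositional.Properties.WithK using (unique∧set⇒bag)
open import Data.List.Properties
  using (length-++; length-map; filter-++; ++-cancelˡ; ∷-injectiveˡ; ∷-injectiveʳ)
open import Data.List.Relation.Binary.BagAndSetEquality using (∼bag⇒↭)
open import Data.List.Relation.Binary.Infix.Heterogeneous using (Infix; here; there)
open import Data.List.Relation.Binary.Permutation.Propositional
  using (_↭_; refl; prep; module PermutationReasoning)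
open import Data.List.Relation.Binary.Permutation.Propositional.Properties
  using (↭-length; filter-↭; shifts; ++⁺ˡ)
open import Data.List.Relation.Binary.Pointwise.Base using ([]; _∷_)
open import Data.List.Relation.Binary.Prefix.Heterogeneous using (Prefix; []; _∷_)
open import Data.List.Relation.Binary.Suffix.Heterogeneous using (Suffix; here; there)
open import Data.List.Relation.Unary.Any using (here; there)
open import Data.List.Relation.Unary.Unique.Propositional using (Unique)
import Data.List.Relation.Unary.Unique.Propositional.Properties as Unique
open import Data.Nat.Base as ℕ using (ℕ; zero; suc; z≤n; s≤s)
open import Data.Nat.Combinatorics using (_C_; nCn≡1; nCk≡nC[n∸k]; nCk+nC[k+1]≡[n+1]C[k+1])
import Data.Nat.Properties as ℕ
open import Data.Product.Base using (∃; _×_; _,_; proj₁; proj₂; uncurry)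
open import Data.Sum.Base using (inj₁; inj₂)
open import Function.Base using (_∘_)
open import Function.Bundles using (_⇔_; mk⇔; Equivalence)
open import Level using (0ℓ)
open import Relation.Binary.Core using (Rel)
open import Relation.Binary.Definitions using (Asymmetric)
import Relation.Binary.Definitions as Binary
open import Relation.Binary.PropositionalEquality.Core
  using (_≡_; _≢_; refl; sym; trans; cong; cong₂; subst)
open import Relation.Binary.PropositionalEquality.Properties using (module ≡-Reasoning)
open import Relation.Nullary.Decidable using (yes; no; _⊎-dec_)
open import Relation.Nullary.Negation using (¬_; contradiction)
open import Relation.Unary using (Pred; Decidable)

private variable
  A B : Set

-- Counting in lists

-- Without repetitions, having the same elements already means being permutations of each other.
-- Both recurrences below are proved this way: by membership, uniqueness and disjointness of the
-- parts.
unique∧set⇒length : {xs ys : List A} → Unique xs → Unique ys →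
                    (∀ {x} → x ∈ xs ⇔ x ∈ ys) → length xs ≡ length ys
unique∧set⇒length xs! ys! xs∼ys =
  ↭-length (∼bag⇒↭ (unique∧set⇒bag xs! ys! xs∼ys))

∉⇒length≡0 : (xs : List A) → (∀ {x} → ¬ x ∈ xs) → length xs ≡ 0
∉⇒length≡0 []       ∉xs = refl
∉⇒length≡0 (x ∷ xs) ∉xs = contradiction (here refl) ∉xs

count : {P : Pred A 0ℓ} → Decidable P → List A → ℕ
count P? xs = length (filter P? xs)

count-++ : {P : Pred A 0ℓ} (P? : Decidable P) (xs ys : List A) →
           count P? (xs ++ ys) ≡ count P? xs ℕ.+ count P? ys
count-++ P? xs ys =
  trans (cong length (filter-++ P? xs ys)) (length-++ (filter P? xs))

-- The product unfolds by rows; peeling off a column reorders the entries, hence a permutation in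
-- place of an equality.
cartesianProduct-∷ʳ : (xs : List A) (y : B) (ys : List B) →
  cartesianProduct xs (y ∷ ys) ↭ map (_, y) xs ++ cartesianProduct xs ys
cartesianProduct-∷ʳ []       y ys = refl
cartesianProduct-∷ʳ (x ∷ xs) y ys = prep (x , y) (begin
  map (x ,_) ys ++ cartesianProduct xs (y ∷ ys)
    ↭⟨ ++⁺ˡ (map (x ,_) ys) (cartesianProduct-∷ʳ xs y ys) ⟩
  map (x ,_) ys ++ map (_, y) xs ++ cartesianProduct xs ys
    ↭⟨ shifts (map (x ,_) ys) (map (_, y) xs) ⟩
  map (_, y) xs ++ map (x ,_) ys ++ cartesianProduct xs ys ∎)
  where open PermutationReasoning

module _ {_⇝_ : Rel A 0ℓ} (_⇝?_ : Binary.Decidable _⇝_) (⇝-asym : Asymmetric _⇝_) where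

  private
    ⇝₂? = uncurry _⇝?_
    ⇄₂? = uncurry (λ x y → (x ⇝? y) ⊎-dec (y ⇝? x))

  -- By asymmetry at most one of `x ⇝ y` and `y ⇝ x` holds, so no `y` is counted twice on the right.
  count-symmetrized-row : ∀ x ys →
    count ⇄₂? (map (x ,_) ys) ≡ count ⇝₂? (map (x ,_) ys) ℕ.+ count ⇝₂? (map (_, x) ys)
  count-symmetrized-row x []       = refl
  count-symmetrized-row x (y ∷ ys) with x ⇝? y | y ⇝? x
  ... | yes p | yes q = contradiction q (⇝-asym p)
  ... | yes p | no _  = cong suc (count-symmetrized-row x ys)
  ... | no _  | yes q = trans (cong suc (count-symmetrized-row x ys)) (sym (ℕ.+-suc _ _))
  ... | no _  | no _  = count-symmetrized-row x ys

  -- Each pair in `pairs` occurs in the product in both orders, of which at most one is related.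
  -- This turns a count of undirected edges into a count of directed ones.
  count-symmetrized : ∀ xs → count ⇄₂? (pairs xs) ≡ count ⇝₂? (cartesianProduct xs xs)
  count-symmetrized []       = refl
  count-symmetrized (x ∷ xs) = begin
    count ⇄₂? (map (x ,_) xs ++ pairs xs)
      ≡⟨ count-++ ⇄₂? (map (x ,_) xs) (pairs xs) ⟩
    count ⇄₂? (map (x ,_) xs) ℕ.+ count ⇄₂? (pairs xs)
      ≡⟨ cong₂ ℕ._+_ (count-symmetrized-row x xs) (count-symmetrized xs) ⟩
    (row ℕ.+ column) ℕ.+ count ⇝₂? (cartesianProduct xs xs)
      ≡⟨ ℕ.+-assoc row column _ ⟩
    row ℕ.+ (column ℕ.+ count ⇝₂? (cartesianProduct xs xs))
      ≡⟨ cong (row ℕ.+_) (count-++ ⇝₂? (map (_, x) xs) _) ⟨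
    row ℕ.+ count ⇝₂? (map (_, x) xs ++ cartesianProduct xs xs)
      ≡⟨ cong (row ℕ.+_) (↭-length (filter-↭ ⇝₂? (cartesianProduct-∷ʳ xs x xs))) ⟨
    row ℕ.+ count ⇝₂? (cartesianProduct xs (x ∷ xs))
      ≡⟨ count-++ ⇝₂? (map (x ,_) xs) _ ⟨
    count ⇝₂? (map (x ,_) xs ++ cartesianProduct xs (x ∷ xs))
      ≡⟨ off-diagonal ⟨
    count ⇝₂? (cartesianProduct (x ∷ xs) (x ∷ xs)) ∎
    where
    open ≡-Reasoning
    row    = count ⇝₂? (map (x ,_) xs)
    column = count ⇝₂? (map (_, x) xs)

    -- The first entry of the product is `(x , x)`, which asymmetry rules out.
    off-diagonal : count ⇝₂? (cartesianProduct (x ∷ xs) (x ∷ xs)) ≡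
                   count ⇝₂? (map (x ,_) xs ++ cartesianProduct xs (x ∷ xs))
    off-diagonal with x ⇝? x
    ... | yes p = contradiction p (⇝-asym p)
    ... | no _  = refl

-- Padovan words as block sequences

-- The word 0 followed by blocks 10 and 110 is bracketed here as blocks 01 and 011 followed by a
-- final 0. A block is then a prefix, and what remains after it again starts with 0.
data Blocks : Word → Set where
  base  : Blocks [ 𝟎 ]
  short : ∀ {w} → Blocks w → Blocks (𝟎 ∷ 𝟏 ∷ w)
  long  : ∀ {w} → Blocks w → Blocks (𝟎 ∷ 𝟏 ∷ 𝟏 ∷ w)

blocks⇒starts-with-𝟎 : ∀ {w} → Blocks w → Prefix _≡_ [ 𝟎 ] w
blocks⇒starts-with-𝟎 base      = refl ∷ []
blocks⇒starts-with-𝟎 (short _) = refl ∷ []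
blocks⇒starts-with-𝟎 (long _)  = refl ∷ []

blocks⇒ends-with-𝟎 : ∀ {w} → Blocks w → Suffix _≡_ [ 𝟎 ] w
blocks⇒ends-with-𝟎 base      = here (refl ∷ [])
blocks⇒ends-with-𝟎 (short b) = there (there (blocks⇒ends-with-𝟎 b))
blocks⇒ends-with-𝟎 (long b)  = there (there (there (blocks⇒ends-with-𝟎 b)))

blocks⇒no-𝟎𝟎 : ∀ {w} → Blocks w → ¬ Infix _≡_ (𝟎 ∷ 𝟎 ∷ []) w
blocks⇒no-𝟎𝟎 base      (here (_ ∷ ()))
blocks⇒no-𝟎𝟎 base      (there (here ()))
blocks⇒no-𝟎𝟎 (short b) (here (_ ∷ () ∷ _))
blocks⇒no-𝟎𝟎 (short b) (there (here (() ∷ _)))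
blocks⇒no-𝟎𝟎 (short b) (there (there i)) = blocks⇒no-𝟎𝟎 b i
blocks⇒no-𝟎𝟎 (long b)  (here (_ ∷ () ∷ _))
blocks⇒no-𝟎𝟎 (long b)  (there (here (() ∷ _)))
blocks⇒no-𝟎𝟎 (long b)  (there (there (here (() ∷ _))))
blocks⇒no-𝟎𝟎 (long b)  (there (there (there i))) = blocks⇒no-𝟎𝟎 b i

-- An occurrence that starts inside a block would run into the next one, which begins with 0.
blocks⇒no-𝟏𝟏𝟏 : ∀ {w} → Blocks w → ¬ Infix _≡_ (𝟏 ∷ 𝟏 ∷ 𝟏 ∷ []) w
blocks⇒no-𝟏𝟏𝟏 base      (here (() ∷ _))
blocks⇒no-𝟏𝟏𝟏 base      (there (here ()))
blocks⇒no-𝟏𝟏𝟏 (short b) (here (() ∷ _))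
blocks⇒no-𝟏𝟏𝟏 (short b) (there (here (_ ∷ refl ∷ _))) with () ← b
blocks⇒no-𝟏𝟏𝟏 (short b) (there (there i)) = blocks⇒no-𝟏𝟏𝟏 b i
blocks⇒no-𝟏𝟏𝟏 (long b)  (here (() ∷ _))
blocks⇒no-𝟏𝟏𝟏 (long b)  (there (here (_ ∷ _ ∷ refl ∷ _))) with () ← b
blocks⇒no-𝟏𝟏𝟏 (long b)  (there (there (here (_ ∷ refl ∷ _)))) with () ← b
blocks⇒no-𝟏𝟏𝟏 (long b)  (there (there (there i))) = blocks⇒no-𝟏𝟏𝟏 b i

blocks⇒padovan : ∀ {w} → Blocks w → IsPadovan w
blocks⇒padovan b = padovan (blocks⇒starts-with-𝟎 b) (blocks⇒ends-with-𝟎 b)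
                           (blocks⇒no-𝟎𝟎 b) (blocks⇒no-𝟏𝟏𝟏 b)

suffix-∷⁻ : ∀ {a b c : Bool} {w} → Suffix _≡_ [ a ] (b ∷ c ∷ w) → Suffix _≡_ [ a ] (c ∷ w)
suffix-∷⁻ (here (_ ∷ ()))
suffix-∷⁻ (there s) = s

-- After the leading 0, the excluded 00 and the final 0 leave either the word 0 itself or a run of
-- ones followed by 0; excluding 111 bounds the run by two. The rest inherits all four conditions.
padovan⇒blocks : ∀ w → IsPadovan w → Blocks w
padovan⇒blocks [] (padovan () _ _ _)
padovan⇒blocks (𝟏 ∷ _) (padovan (() ∷ _) _ _ _)
padovan⇒blocks (𝟎 ∷ []) _ = base
padovan⇒blocks (𝟎 ∷ 𝟎 ∷ _) (padovan _ _ no-𝟎𝟎 _) =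
  contradiction (here (refl ∷ refl ∷ [])) no-𝟎𝟎
padovan⇒blocks (𝟎 ∷ 𝟏 ∷ []) (padovan _ e _ _) with suffix-∷⁻ e
... | here (() ∷ _)
... | there (here ())
padovan⇒blocks (𝟎 ∷ 𝟏 ∷ 𝟎 ∷ w) (padovan _ e f g) =
  short (padovan⇒blocks (𝟎 ∷ w)
    (padovan (refl ∷ []) (suffix-∷⁻ (suffix-∷⁻ e))
             (λ i → f (there (there i))) (λ i → g (there (there i)))))
padovan⇒blocks (𝟎 ∷ 𝟏 ∷ 𝟏 ∷ []) (padovan _ e _ _) with suffix-∷⁻ (suffix-∷⁻ e)
... | here (() ∷ _)
... | there (here ())
padovan⇒blocks (𝟎 ∷ 𝟏 ∷ 𝟏 ∷ 𝟎 ∷ w) (padovan _ e f g) =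
  long (padovan⇒blocks (𝟎 ∷ w)
    (padovan (refl ∷ []) (suffix-∷⁻ (suffix-∷⁻ (suffix-∷⁻ e)))
             (λ i → f (there (there (there i)))) (λ i → g (there (there (there i))))))
padovan⇒blocks (𝟎 ∷ 𝟏 ∷ 𝟏 ∷ 𝟏 ∷ _) (padovan _ _ _ no-𝟏𝟏𝟏) =
  contradiction (there (here (refl ∷ refl ∷ refl ∷ []))) no-𝟏𝟏𝟏

-- Moves between block sequences

-- At the first position where the two words differ, a move turns 0 into 1, so no move leads back.
⟶-asym : Asymmetric _⟶_
⟶-asym ([] , _ , refl , refl) ([] , _ , () , _)
⟶-asym ([] , _ , refl , refl) (_ ∷ _ , _ , p , q)
  with () ← trans (∷-injectiveˡ p) (sym (∷-injectiveˡ q))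
⟶-asym (_ ∷ _ , _ , refl , refl) ([] , _ , p , q)
  with () ← trans (sym (∷-injectiveˡ p)) (∷-injectiveˡ q)
⟶-asym (_ ∷ u , v , refl , refl) (_ ∷ u′ , v′ , p , q) =
  ⟶-asym (u , v , refl , refl) (u′ , v′ , ∷-injectiveʳ p , ∷-injectiveʳ q)

-- The first letters differ, so the move takes place at the front.
𝟎⟶𝟏 : ∀ {x y} → (𝟎 ∷ x) ⟶ (𝟏 ∷ y) → ∃ λ v → x ≡ 𝟏 ∷ v × y ≡ 𝟎 ∷ v
𝟎⟶𝟏 ([] , v , p , q) = v , ∷-injectiveʳ p , ∷-injectiveʳ q
𝟎⟶𝟏 (_ ∷ _ , _ , p , q) with () ← trans (∷-injectiveˡ p) (sym (∷-injectiveˡ q))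

𝟏⟶̸𝟎 : ∀ {x y} → ¬ (𝟏 ∷ x) ⟶ (𝟎 ∷ y)
𝟏⟶̸𝟎 ([] , _ , () , _)
𝟏⟶̸𝟎 (_ ∷ _ , _ , p , q) with () ← trans (∷-injectiveˡ p) (sym (∷-injectiveˡ q))

-- Both words being Padovan, a move 01 → 10 exchanges two consecutive blocks 10 and 110.
data Arc : Rel Word 0ℓ where
  in-tail-01  : ∀ {x y} → Blocks x → Blocks y → x ⟶ y → Arc (𝟎 ∷ 𝟏 ∷ x) (𝟎 ∷ 𝟏 ∷ y)
  in-tail-011 : ∀ {x y} → Blocks x → Blocks y → x ⟶ y → Arc (𝟎 ∷ 𝟏 ∷ 𝟏 ∷ x) (𝟎 ∷ 𝟏 ∷ 𝟏 ∷ y)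
  exchange    : ∀ {z} → Blocks z → Arc (𝟎 ∷ 𝟏 ∷ 𝟎 ∷ 𝟏 ∷ 𝟏 ∷ z) (𝟎 ∷ 𝟏 ∷ 𝟏 ∷ 𝟎 ∷ 𝟏 ∷ z)

-- The first blocks are compared. Equal ones cancel. If they are 01 and 011, the move acts directly
-- after the common 01. The order 011, 01 would require a move from 1 to 0 at the first difference.
arc : ∀ {x y} → Blocks x → Blocks y → x ⟶ y → Arc x y
arc base _ ([] , _ , () , _)
arc base _ (_ ∷ [] , _ , () , _)
arc base _ (_ ∷ _ ∷ _ , _ , () , _)
arc (short _) base ([] , _ , _ , ())
arc (short _) base (_ ∷ [] , _ , _ , ())
arc (short _) base (_ ∷ _ ∷ _ , _ , _ , ())
arc (long _) base ([] , _ , _ , ())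
arc (long _) base (_ ∷ [] , _ , _ , ())
arc (long _) base (_ ∷ _ ∷ _ , _ , _ , ())
arc (short p) (short q) m = in-tail-01 p q (⟶-∷⁻ (⟶-∷⁻ m))
arc (long p) (long q) m = in-tail-011 p q (⟶-∷⁻ (⟶-∷⁻ (⟶-∷⁻ m)))
arc (short base) (long _) m with _ , () , _ ← 𝟎⟶𝟏 (⟶-∷⁻ (⟶-∷⁻ m))
-- The move would make the word of `q` a 0 followed by the word of `r`, which itself begins with 0;
-- this is the forbidden 00.
arc (short (short r)) (long q) m
  with _ , refl , refl ← 𝟎⟶𝟏 (⟶-∷⁻ (⟶-∷⁻ m))
  with q | r
... | short _ | ()
... | long _  | ()
arc (short (long r)) (long q) m
  with _ , refl , refl ← 𝟎⟶𝟏 (⟶-∷⁻ (⟶-∷⁻ m)) = exchange r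
arc (long _) (short base)      m = ⊥-elim (𝟏⟶̸𝟎 (⟶-∷⁻ (⟶-∷⁻ m)))
arc (long _) (short (short _)) m = ⊥-elim (𝟏⟶̸𝟎 (⟶-∷⁻ (⟶-∷⁻ m)))
arc (long _) (short (long _))  m = ⊥-elim (𝟏⟶̸𝟎 (⟶-∷⁻ (⟶-∷⁻ m)))

-- The admissible range

-- Together with the bound of `(n / d) * d` by `n`, this characterizes the floor. The next four
-- lemmas use the two bounds to trade quotients for products.
n<suc[n/d]*d : ∀ n d .{{_ : ℕ.NonZero d}} → n < ℤ.suc (n / + d) * + d
n<suc[n/d]*d n d =
  subst (λ q → n < ℤ.suc q * + d) (sym (ℤ.div-pos-is-/ℕ n d)) (ℤ.n<s[n/ℕd]*d n d)

j≤i/d⇒j*d≤i : ∀ i j d .{{_ : ℕ.NonZero d}} → j ≤ i / + d → j * + d ≤ i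
j≤i/d⇒j*d≤i i j d j≤i/d =
  ℤ.≤-trans (ℤ.*-monoʳ-≤-nonNeg (+ d) j≤i/d) (ℤ.[n/d]*d≤n i (+ d))

i/d≤j⇒i<suc[j]*d : ∀ i j d .{{_ : ℕ.NonZero d}} → i / + d ≤ j → i < ℤ.suc j * + d
i/d≤j⇒i<suc[j]*d i j d i/d≤j =
  ℤ.<-≤-trans (n<suc[n/d]*d i d) (ℤ.*-monoʳ-≤-nonNeg (+ d) (ℤ.suc-mono i/d≤j))

j*d≤i⇒j≤i/d : ∀ i j d .{{_ : ℕ.NonZero d}} → j * + d ≤ i → j ≤ i / + d
j*d≤i⇒j≤i/d i j d j*d≤i = ℤ.≮⇒≥ λ i/d<j →
  ℤ.<⇒≱ (ℤ.<-≤-trans (n<suc[n/d]*d i d)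
                       (ℤ.*-monoʳ-≤-nonNeg (+ d) (ℤ.i<j⇒suc[i]≤j i/d<j)))
        j*d≤i

i<suc[j]*d⇒i/d≤j : ∀ i j d .{{_ : ℕ.NonZero d}} → i < ℤ.suc j * + d → i / + d ≤ j
i<suc[j]*d⇒i/d≤j i j d i<[1+j]*d = ℤ.≮⇒≥ λ j<i/d →
  ℤ.<⇒≱ i<[1+j]*d (j≤i/d⇒j*d≤i i (ℤ.suc j) d (ℤ.i<j⇒suc[i]≤j j<i/d))

-- The numbers of blocks 10 and of blocks 110 in a Padovan word of length n
-- with k letters 1.
shorts longs : ℤ → ℤ → ℤ
shorts n k = + 2 * n - + 3 * k - + 2
longs  n k = + 2 * k - n + 1ℤ

inRange⇒0≤shorts : ∀ {n k} → InRange n k → 0ℤ ≤ shorts n k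
inRange⇒0≤shorts {n} {k} (inRange _ _ upper) =
  subst (0ℤ ≤_) (regroup n k) (ℤ.i≤j⇒0≤j-i (j≤i/d⇒j*d≤i (+ 2 * n - + 2) k 3 upper))
  where
  regroup : ∀ n k → (+ 2 * n - + 2) - k * + 3 ≡ + 2 * n - + 3 * k - + 2
  regroup = solve-∀

-- The floor condition says `n < 2(k + 1)`, that is `1 + n ≤ 2k + 2` over the integers; this is
-- where the summand 1 in `longs` comes from.
inRange⇒0≤longs : ∀ {n k} → InRange n k → 0ℤ ≤ longs n k
inRange⇒0≤longs {n} {k} (inRange _ lower _) =
  subst (0ℤ ≤_) (regroup n k)
    (ℤ.i≤j⇒0≤j-i (ℤ.i<j⇒suc[i]≤j (i/d≤j⇒i<suc[j]*d n k 2 lower)))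
  where
  regroup : ∀ n k → (1ℤ + k) * + 2 - (1ℤ + n) ≡ + 2 * k - n + 1ℤ
  regroup = solve-∀

0≤shorts∧longs⇒inRange : ∀ {n k} → 1ℤ ≤ n → 0ℤ ≤ shorts n k → 0ℤ ≤ longs n k → InRange n k
0≤shorts∧longs⇒inRange {n} {k} 1≤n 0≤s 0≤l = inRange 1≤n
  (i<suc[j]*d⇒i/d≤j n k 2 (ℤ.suc[i]≤j⇒i<j (ℤ.0≤i-j⇒j≤i (subst (0ℤ ≤_) (longs≡ n k) 0≤l))))
  (j*d≤i⇒j≤i/d (+ 2 * n - + 2) k 3 (ℤ.0≤i-j⇒j≤i (subst (0ℤ ≤_) (shorts≡ n k) 0≤s)))
  where
  longs≡ : ∀ n k → + 2 * k - n + 1ℤ ≡ (1ℤ + k) * + 2 - (1ℤ + n)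
  longs≡ = solve-∀

  shorts≡ : ∀ n k → + 2 * n - + 3 * k - + 2 ≡ (+ 2 * n - + 2) - k * + 3
  shorts≡ = solve-∀

-- The value is 0 on the word 0, a block 01 raises it by one, and a block 011 leaves it unchanged.
-- For `longs` the two blocks swap roles.
blocks⇒0≤shorts : ∀ {w} → Blocks w → 0ℤ ≤ shorts (+ length w) (+ #𝟏 w)
blocks⇒0≤shorts base = +≤+ z≤n
blocks⇒0≤shorts (short {w} b) =
  subst (0ℤ ≤_) (step (+ length w) (+ #𝟏 w)) (ℤ.i≤j⇒i≤1+j (blocks⇒0≤shorts b))
  where
  step : ∀ l c → 1ℤ + (+ 2 * l - + 3 * c - + 2) ≡ + 2 * (+ 2 + l) - + 3 * (+ 1 + c) - + 2
  step = solve-∀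
blocks⇒0≤shorts (long {w} b) =
  subst (0ℤ ≤_) (step (+ length w) (+ #𝟏 w)) (blocks⇒0≤shorts b)
  where
  step : ∀ l c → + 2 * l - + 3 * c - + 2 ≡ + 2 * (+ 3 + l) - + 3 * (+ 2 + c) - + 2
  step = solve-∀

blocks⇒0≤longs : ∀ {w} → Blocks w → 0ℤ ≤ longs (+ length w) (+ #𝟏 w)
blocks⇒0≤longs base = +≤+ z≤n
blocks⇒0≤longs (short {w} b) =
  subst (0ℤ ≤_) (step (+ length w) (+ #𝟏 w)) (blocks⇒0≤longs b)
  where
  step : ∀ l c → + 2 * c - l + 1ℤ ≡ + 2 * (+ 1 + c) - (+ 2 + l) + 1ℤ
  step = solve-∀
blocks⇒0≤longs (long {w} b) =
  subst (0ℤ ≤_) (step (+ length w) (+ #𝟏 w)) (ℤ.i≤j⇒i≤1+j (blocks⇒0≤longs b))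
  where
  step : ∀ l c → 1ℤ + (+ 2 * c - l + 1ℤ) ≡ + 2 * (+ 2 + c) - (+ 3 + l) + 1ℤ
  step = solve-∀

blocks⇒1≤length : ∀ {w} → Blocks w → 1ℤ ≤ + length w
blocks⇒1≤length base      = +≤+ (s≤s z≤n)
blocks⇒1≤length (short _) = +≤+ (s≤s z≤n)
blocks⇒1≤length (long _)  = +≤+ (s≤s z≤n)

-- The range condition follows from the block structure, so the convention for pairs outside the
-- range discards no Padovan word. The recurrences may therefore step outside the range.
blocks⇒vertex : ∀ {n k w} → Blocks w → + length w ≡ n → + #𝟏 w ≡ k → IsΦVertex n k w
blocks⇒vertex b refl refl = φVertex
  (0≤shorts∧longs⇒inRange (blocks⇒1≤length b) (blocks⇒0≤shorts b) (blocks⇒0≤longs b))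
  refl (blocks⇒padovan b) refl

vertex⇒blocks : ∀ {n k w} → IsΦVertex n k w → Blocks w
vertex⇒blocks {w = w} v = padovan⇒blocks w (IsΦVertex.is-padovan v)

-- Recurrences

vertices : ℤ → ℤ → List Word
vertices n k = FiniteSimpleGraph.vertices (Φ n k)

vertices-unique : ∀ n k → Unique (vertices n k)
vertices-unique n k = FiniteSimpleGraph.unique (Φ n k)

∈-vertices⁺ : ∀ n k {w} → IsΦVertex n k w → w ∈ vertices n k
∈-vertices⁺ n k {w} = Equivalence.from (FiniteSimpleGraph.∈-vertices (Φ n k) w)

∈-vertices⁻ : ∀ n k {w} → w ∈ vertices n k → IsΦVertex n k w
∈-vertices⁻ n k {w} = Equivalence.to (FiniteSimpleGraph.∈-vertices (Φ n k) w)

#𝟏-++ : ∀ u w → #𝟏 (u ++ w) ≡ #𝟏 u ℕ.+ #𝟏 w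
#𝟏-++ = count-++ (Bool._≟ 𝟏)

+[m+n]≡i⇒+n≡i-+m : ∀ {m n l i} → l ≡ m ℕ.+ n → + l ≡ i → + n ≡ i - + m
+[m+n]≡i⇒+n≡i-+m {m} {n} refl refl = cancel (+ m) (+ n)
  where
  cancel : ∀ i j → j ≡ i + j - i
  cancel = solve-∀

+n≡i-+m⇒+[m+n]≡i : ∀ {m n l i} → l ≡ m ℕ.+ n → + n ≡ i - + m → + l ≡ i
+n≡i-+m⇒+[m+n]≡i {m} {n} {i = i} refl eq = trans (cong (_+_ (+ m)) eq) (cancel (+ m) i)
  where
  cancel : ∀ i j → i + (j - i) ≡ j
  cancel = solve-∀

-- For the prefixes 01, 011 and 01011 the shifts evaluate to (2, 1), (3, 2) and (5, 3), the index
-- shifts of the recurrences.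
vertex-++⁻ : ∀ u {n k w} → Blocks w → IsΦVertex n k (u ++ w) →
             IsΦVertex (n - + length u) (k - + #𝟏 u) w
vertex-++⁻ u {w = w} b (φVertex _ length≡n _ #𝟏≡k) =
  blocks⇒vertex b (+[m+n]≡i⇒+n≡i-+m (length-++ u) length≡n)
                  (+[m+n]≡i⇒+n≡i-+m (#𝟏-++ u w) #𝟏≡k)

vertex-++⁺ : ∀ u {n k w} → Blocks (u ++ w) → IsΦVertex (n - + length u) (k - + #𝟏 u) w →
             IsΦVertex n k (u ++ w)
vertex-++⁺ u {w = w} b (φVertex _ length≡ _ #𝟏≡) =
  blocks⇒vertex b (+n≡i-+m⇒+[m+n]≡i (length-++ u) length≡)
                  (+n≡i-+m⇒+[m+n]≡i (#𝟏-++ u w) #𝟏≡)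

pattern 𝟎𝟏     = 𝟎 ∷ 𝟏 ∷ []
pattern 𝟎𝟏𝟏    = 𝟎 ∷ 𝟏 ∷ 𝟏 ∷ []
pattern 𝟎𝟏𝟎𝟏𝟏 = 𝟎 ∷ 𝟏 ∷ 𝟎 ∷ 𝟏 ∷ 𝟏 ∷ []
pattern 𝟎𝟏𝟏𝟎𝟏 = 𝟎 ∷ 𝟏 ∷ 𝟏 ∷ 𝟎 ∷ 𝟏 ∷ []

-- The vertices are split by their first block. Excluding `n = 1` removes the word 0, the only
-- Padovan word without a block.
∣V∣-recurrence : ∀ n k → n ≢ 1ℤ →
  ∣V Φ n k ∣ ≡ ∣V Φ (n - + 2) (k - + 1) ∣ ℕ.+ ∣V Φ (n - + 3) (k - + 2) ∣
∣V∣-recurrence n k n≢1 = begin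
  length (vertices n k)
    ≡⟨ unique∧set⇒length (vertices-unique n k) unique (mk⇔ (to ∘ ∈-vertices⁻ n k) from) ⟩
  length (via-𝟎𝟏 ++ via-𝟎𝟏𝟏)
    ≡⟨ length-++ via-𝟎𝟏 ⟩
  length via-𝟎𝟏 ℕ.+ length via-𝟎𝟏𝟏
    ≡⟨ cong₂ ℕ._+_ (length-map _ V₁) (length-map _ V₂) ⟩
  length V₁ ℕ.+ length V₂ ∎
  where
  open ≡-Reasoning
  n₁ = n - + 2
  k₁ = k - + 1
  n₂ = n - + 3
  k₂ = k - + 2
  V₁ = vertices n₁ k₁
  V₂ = vertices n₂ k₂
  via-𝟎𝟏  = map (𝟎𝟏 ++_) V₁
  via-𝟎𝟏𝟏 = map (𝟎𝟏𝟏 ++_) V₂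

  to : ∀ {w} → IsΦVertex n k w → w ∈ via-𝟎𝟏 ++ via-𝟎𝟏𝟏
  to v with vertex⇒blocks v
  ... | base    = contradiction (sym (IsΦVertex.length≡n v)) n≢1
  ... | short b = ∈-++⁺ˡ (∈-map⁺ (𝟎𝟏 ++_) (∈-vertices⁺ n₁ k₁ (vertex-++⁻ 𝟎𝟏 b v)))
  ... | long b  = ∈-++⁺ʳ via-𝟎𝟏 (∈-map⁺ (𝟎𝟏𝟏 ++_) (∈-vertices⁺ n₂ k₂ (vertex-++⁻ 𝟎𝟏𝟏 b v)))

  from : ∀ {w} → w ∈ via-𝟎𝟏 ++ via-𝟎𝟏𝟏 → w ∈ vertices n k
  from w∈ with ∈-++⁻ via-𝟎𝟏 w∈
  ... | inj₁ p with _ , x∈ , refl ← ∈-map⁻ (𝟎𝟏 ++_) p =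
    let v = ∈-vertices⁻ n₁ k₁ x∈ in ∈-vertices⁺ n k (vertex-++⁺ 𝟎𝟏 (short (vertex⇒blocks v)) v)
  ... | inj₂ p with _ , x∈ , refl ← ∈-map⁻ (𝟎𝟏𝟏 ++_) p =
    let v = ∈-vertices⁻ n₂ k₂ x∈ in ∈-vertices⁺ n k (vertex-++⁺ 𝟎𝟏𝟏 (long (vertex⇒blocks v)) v)

  -- A common word would be 01 followed by a vertex that starts with 1.
  disjoint : ∀ {w} → ¬ (w ∈ via-𝟎𝟏 × w ∈ via-𝟎𝟏𝟏)
  disjoint (p , q)
    with x , x∈ , refl ← ∈-map⁻ (𝟎𝟏 ++_) p
       | y , _  , eq   ← ∈-map⁻ (𝟎𝟏𝟏 ++_) q
    with refl ← ++-cancelˡ 𝟎𝟏 x (𝟏 ∷ y) eq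
    with () ← vertex⇒blocks (∈-vertices⁻ n₁ k₁ x∈)

  unique : Unique (via-𝟎𝟏 ++ via-𝟎𝟏𝟏)
  unique = Unique.++⁺ (Unique.map⁺ (++-cancelˡ 𝟎𝟏 _ _) (vertices-unique n₁ k₁))
                      (Unique.map⁺ (++-cancelˡ 𝟎𝟏𝟏 _ _) (vertices-unique n₂ k₂))
                      disjoint

-- Edges oriented by their moves

-- In `edges` a pair is ordered by position in the vertex list; here it is ordered by the direction
-- of the move, which adding a common prefix preserves.
arcs : ℤ → ℤ → List (Word × Word)
arcs n k = filter (uncurry _⟶?_) (cartesianProduct (vertices n k) (vertices n k))

∣E∣≡∣arcs∣ : ∀ n k → ∣E Φ n k ∣ ≡ length (arcs n k)
∣E∣≡∣arcs∣ n k = count-symmetrized _⟶?_ ⟶-asym (vertices n k)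

arcs-unique : ∀ n k → Unique (arcs n k)
arcs-unique n k = Unique.filter⁺ (uncurry _⟶?_)
  (Unique.cartesianProduct⁺ (vertices-unique n k) (vertices-unique n k))

∈-arcs⁺ : ∀ n k {x y} → IsΦVertex n k x → IsΦVertex n k y → x ⟶ y → (x , y) ∈ arcs n k
∈-arcs⁺ n k vx vy x⟶y = ∈-filter⁺ (uncurry _⟶?_)
  (∈-cartesianProduct⁺ (∈-vertices⁺ n k vx) (∈-vertices⁺ n k vy)) x⟶y

∈-arcs⁻ : ∀ n k {x y} → (x , y) ∈ arcs n k → IsΦVertex n k x × IsΦVertex n k y × x ⟶ y
∈-arcs⁻ n k xy∈
  with xy∈V² , x⟶y ← ∈-filter⁻ (uncurry _⟶?_)
                       {xs = cartesianProduct (vertices n k) (vertices n k)} xy∈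
  with x∈ , y∈ ← ∈-cartesianProduct⁻ (vertices n k) (vertices n k) xy∈V²
  = ∈-vertices⁻ n k x∈ , ∈-vertices⁻ n k y∈ , x⟶y

_++²_ : Word → Word × Word → Word × Word
u ++² (x , y) = u ++ x , u ++ y

++²-injective : ∀ u {p q} → u ++² p ≡ u ++² q → p ≡ q
++²-injective u {x , y} {x′ , y′} eq =
  cong₂ _,_ (++-cancelˡ u x x′ (cong proj₁ eq)) (++-cancelˡ u y y′ (cong proj₂ eq))

exchanged : Word → Word × Word
exchanged z = 𝟎𝟏𝟎𝟏𝟏 ++ z , 𝟎𝟏𝟏𝟎𝟏 ++ z

-- The three summands correspond to the three constructors of `Arc`.
∣arcs∣-recurrence : ∀ n k → length (arcs n k) ≡
  length (arcs (n - + 2) (k - + 1)) ℕ.+ length (arcs (n - + 3) (k - + 2)) ℕ.+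
  ∣V Φ (n - + 5) (k - + 3) ∣
∣arcs∣-recurrence n k = begin
  length (arcs n k)
    ≡⟨ unique∧set⇒length (arcs-unique n k) unique (mk⇔ (to ∘ ∈-arcs⁻ n k) from) ⟩
  length ((via-𝟎𝟏 ++ via-𝟎𝟏𝟏) ++ via-exchange)
    ≡⟨ length-++ (via-𝟎𝟏 ++ via-𝟎𝟏𝟏) ⟩
  length (via-𝟎𝟏 ++ via-𝟎𝟏𝟏) ℕ.+ length via-exchange
    ≡⟨ cong (ℕ._+ length via-exchange) (length-++ via-𝟎𝟏) ⟩
  length via-𝟎𝟏 ℕ.+ length via-𝟎𝟏𝟏 ℕ.+ length via-exchange
    ≡⟨ cong₂ ℕ._+_ (cong₂ ℕ._+_ (length-map _ A₁) (length-map _ A₂)) (length-map _ V₃) ⟩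
  length A₁ ℕ.+ length A₂ ℕ.+ length V₃ ∎
  where
  open ≡-Reasoning
  n₁ = n - + 2
  k₁ = k - + 1
  n₂ = n - + 3
  k₂ = k - + 2
  n₃ = n - + 5
  k₃ = k - + 3
  A₁ = arcs n₁ k₁
  A₂ = arcs n₂ k₂
  V₃ = vertices n₃ k₃
  via-𝟎𝟏       = map (𝟎𝟏 ++²_) A₁
  via-𝟎𝟏𝟏      = map (𝟎𝟏𝟏 ++²_) A₂
  via-exchange = map exchanged V₃

  to : ∀ {x y} → IsΦVertex n k x × IsΦVertex n k y × x ⟶ y →
       (x , y) ∈ (via-𝟎𝟏 ++ via-𝟎𝟏𝟏) ++ via-exchange
  to (vx , vy , x⟶y) with arc (vertex⇒blocks vx) (vertex⇒blocks vy) x⟶y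
  ... | in-tail-01 bx by m = ∈-++⁺ˡ (∈-++⁺ˡ
    (∈-map⁺ (𝟎𝟏 ++²_) (∈-arcs⁺ n₁ k₁ (vertex-++⁻ 𝟎𝟏 bx vx) (vertex-++⁻ 𝟎𝟏 by vy) m)))
  ... | in-tail-011 bx by m = ∈-++⁺ˡ (∈-++⁺ʳ via-𝟎𝟏
    (∈-map⁺ (𝟎𝟏𝟏 ++²_) (∈-arcs⁺ n₂ k₂ (vertex-++⁻ 𝟎𝟏𝟏 bx vx) (vertex-++⁻ 𝟎𝟏𝟏 by vy) m)))
  ... | exchange b = ∈-++⁺ʳ (via-𝟎𝟏 ++ via-𝟎𝟏𝟏)
    (∈-map⁺ exchanged (∈-vertices⁺ n₃ k₃ (vertex-++⁻ 𝟎𝟏𝟎𝟏𝟏 b vx)))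

  from : ∀ {xy} → xy ∈ (via-𝟎𝟏 ++ via-𝟎𝟏𝟏) ++ via-exchange → xy ∈ arcs n k
  from xy∈ with ∈-++⁻ (via-𝟎𝟏 ++ via-𝟎𝟏𝟏) xy∈
  from xy∈ | inj₁ p with ∈-++⁻ via-𝟎𝟏 p
  from xy∈ | inj₁ p | inj₁ q
    with _ , xy∈A₁ , refl ← ∈-map⁻ (𝟎𝟏 ++²_) q
    with vx , vy , m ← ∈-arcs⁻ n₁ k₁ xy∈A₁ =
    ∈-arcs⁺ n k (vertex-++⁺ 𝟎𝟏 (short (vertex⇒blocks vx)) vx)
                (vertex-++⁺ 𝟎𝟏 (short (vertex⇒blocks vy)) vy)
                (⟶-∷ 𝟎 (⟶-∷ 𝟏 m))
  from xy∈ | inj₁ p | inj₂ q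
    with _ , xy∈A₂ , refl ← ∈-map⁻ (𝟎𝟏𝟏 ++²_) q
    with vx , vy , m ← ∈-arcs⁻ n₂ k₂ xy∈A₂ =
    ∈-arcs⁺ n k (vertex-++⁺ 𝟎𝟏𝟏 (long (vertex⇒blocks vx)) vx)
                (vertex-++⁺ 𝟎𝟏𝟏 (long (vertex⇒blocks vy)) vy)
                (⟶-∷ 𝟎 (⟶-∷ 𝟏 (⟶-∷ 𝟏 m)))
  from xy∈ | inj₂ p
    with z , z∈ , refl ← ∈-map⁻ exchanged p
    with v ← ∈-vertices⁻ n₃ k₃ z∈ =
    -- Both prefixes have five letters, three of them 1, so the same `v` yields both endpoints. The
    -- move acts on the third and fourth letters.
    ∈-arcs⁺ n k (vertex-++⁺ 𝟎𝟏𝟎𝟏𝟏 (short (long (vertex⇒blocks v))) v)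
                (vertex-++⁺ 𝟎𝟏𝟏𝟎𝟏 (long (short (vertex⇒blocks v))) v)
                (𝟎𝟏 , 𝟏 ∷ z , refl , refl)

  disjoint-tails : ∀ {xy} → ¬ (xy ∈ via-𝟎𝟏 × xy ∈ via-𝟎𝟏𝟏)
  disjoint-tails (p , q)
    with (x , _) , xy∈ , refl ← ∈-map⁻ (𝟎𝟏 ++²_) p
       | (x′ , _) , _  , eq   ← ∈-map⁻ (𝟎𝟏𝟏 ++²_) q
    with refl ← ++-cancelˡ 𝟎𝟏 x (𝟏 ∷ x′) (cong proj₁ eq)
    with () ← vertex⇒blocks (proj₁ (∈-arcs⁻ n₁ k₁ xy∈))

  -- An exchange starts at a word with first block 01 and ends at one with first block 011. The
  -- target thus separates it from `via-𝟎𝟏`, the source from `via-𝟎𝟏𝟏`.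
  disjoint-exchange : ∀ {xy} → ¬ (xy ∈ via-𝟎𝟏 ++ via-𝟎𝟏𝟏 × xy ∈ via-exchange)
  disjoint-exchange (p , q) with z , _ , refl ← ∈-map⁻ exchanged q | ∈-++⁻ via-𝟎𝟏 p
  ... | inj₁ r
    with (_ , y) , xy∈ , eq ← ∈-map⁻ (𝟎𝟏 ++²_) r
    with refl ← ++-cancelˡ 𝟎𝟏 (𝟏 ∷ 𝟎𝟏 ++ z) y (cong proj₂ eq)
    with () ← vertex⇒blocks (proj₁ (proj₂ (∈-arcs⁻ n₁ k₁ xy∈)))
  ... | inj₂ r
    with (x , _) , xy∈ , eq ← ∈-map⁻ (𝟎𝟏𝟏 ++²_) r
    with () ← ++-cancelˡ 𝟎𝟏 (𝟎𝟏𝟏 ++ z) (𝟏 ∷ x) (cong proj₁ eq)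

  unique : Unique ((via-𝟎𝟏 ++ via-𝟎𝟏𝟏) ++ via-exchange)
  unique = Unique.++⁺
    (Unique.++⁺ (Unique.map⁺ (++²-injective 𝟎𝟏) (arcs-unique n₁ k₁))
                (Unique.map⁺ (++²-injective 𝟎𝟏𝟏) (arcs-unique n₂ k₂))
                disjoint-tails)
    (Unique.map⁺ (++-cancelˡ 𝟎𝟏𝟎𝟏𝟏 _ _ ∘ cong proj₁) (vertices-unique n₃ k₃))
    disjoint-exchange

∣E∣-recurrence : ∀ n k → ∣E Φ n k ∣ ≡
  ∣E Φ (n - + 2) (k - + 1) ∣ ℕ.+ ∣E Φ (n - + 3) (k - + 2) ∣ ℕ.+ ∣V Φ (n - + 5) (k - + 3) ∣
∣E∣-recurrence n k
  rewrite ∣E∣≡∣arcs∣ n k | ∣E∣≡∣arcs∣ (n - + 2) (k - + 1) | ∣E∣≡∣arcs∣ (n - + 3) (k - + 2)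
  = ∣arcs∣-recurrence n k

-- The number of vertices

¬inRange⇒∣V∣≡0 : ∀ n k → ¬ InRange n k → ∣V Φ n k ∣ ≡ 0
¬inRange⇒∣V∣≡0 n k ¬r =
  ∉⇒length≡0 (vertices n k) (¬r ∘ IsΦVertex.in-range ∘ ∈-vertices⁻ n k)

module _ {n k : ℤ} {a b : ℕ} (shorts≡a : shorts n k ≡ + a) (longs≡b : longs n k ≡ + b) where

  -- This and `k≡a+2b` invert the linear system defining `shorts` and `longs`. They evaluate `n` and
  -- `k` in the base case and give `n ≢ 1` once some block exists.
  n≡1+2a+3b : n ≡ + (1 ℕ.+ 2 ℕ.* a ℕ.+ 3 ℕ.* b)
  n≡1+2a+3b = begin
    n
      ≡⟨ by-blocks n k ⟩
    1ℤ + + 2 * shorts n k + + 3 * longs n k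
      ≡⟨ cong₂ (λ s l → 1ℤ + + 2 * s + + 3 * l) shorts≡a longs≡b ⟩
    1ℤ + + 2 * + a + + 3 * + b
      ≡⟨ cong₂ (λ s l → 1ℤ + s + l) (ℤ.pos-* 2 a) (ℤ.pos-* 3 b) ⟨
    + (1 ℕ.+ 2 ℕ.* a ℕ.+ 3 ℕ.* b) ∎
    where
    open ≡-Reasoning
    by-blocks : ∀ n k → n ≡ 1ℤ + + 2 * (+ 2 * n - + 3 * k - + 2) + + 3 * (+ 2 * k - n + 1ℤ)
    by-blocks = solve-∀

  k≡a+2b : k ≡ + (a ℕ.+ 2 ℕ.* b)
  k≡a+2b = begin
    k                                ≡⟨ by-blocks n k ⟩
    shorts n k + + 2 * longs n k     ≡⟨ cong₂ (λ s l → s + + 2 * l) shorts≡a longs≡b ⟩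
    + a + + 2 * + b                  ≡⟨ cong (_+_ (+ a)) (ℤ.pos-* 2 b) ⟨
    + (a ℕ.+ 2 ℕ.* b)                ∎
    where
    open ≡-Reasoning
    by-blocks : ∀ n k → k ≡ (+ 2 * n - + 3 * k - + 2) + + 2 * (+ 2 * k - n + 1ℤ)
    by-blocks = solve-∀

module _ (n k : ℤ) where

  shorts-drop-01 : shorts (n - + 2) (k - + 1) ≡ shorts n k - 1ℤ
  shorts-drop-01 = identity n k
    where
    identity : ∀ n k → + 2 * (n - + 2) - + 3 * (k - + 1) - + 2 ≡ (+ 2 * n - + 3 * k - + 2) - 1ℤ
    identity = solve-∀

  longs-drop-01 : longs (n - + 2) (k - + 1) ≡ longs n k
  longs-drop-01 = identity n k
    where
    identity : ∀ n k → + 2 * (k - + 1) - (n - + 2) + 1ℤ ≡ + 2 * k - n + 1ℤ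
    identity = solve-∀

  shorts-drop-011 : shorts (n - + 3) (k - + 2) ≡ shorts n k
  shorts-drop-011 = identity n k
    where
    identity : ∀ n k → + 2 * (n - + 3) - + 3 * (k - + 2) - + 2 ≡ + 2 * n - + 3 * k - + 2
    identity = solve-∀

  longs-drop-011 : longs (n - + 3) (k - + 2) ≡ longs n k - 1ℤ
  longs-drop-011 = identity n k
    where
    identity : ∀ n k → + 2 * (k - + 2) - (n - + 3) + 1ℤ ≡ (+ 2 * k - n + 1ℤ) - 1ℤ
    identity = solve-∀

nC0≡1 : ∀ n → n C 0 ≡ 1
nC0≡1 n = trans (nCk≡nC[n∸k] {n = n} z≤n) (nCn≡1 n)

-- Removing a block 10 would bring the count to -1, which lies outside the range, where the graph is
-- empty by convention.
no-shorts⇒∣V∣≡0 : ∀ n k → shorts n k ≡ + 0 → ∣V Φ (n - + 2) (k - + 1) ∣ ≡ 0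
no-shorts⇒∣V∣≡0 n k s≡0 = ¬inRange⇒∣V∣≡0 (n - + 2) (k - + 1) λ r → contradiction
  (subst (0ℤ ≤_) (trans (shorts-drop-01 n k) (cong (_- 1ℤ) s≡0)) (inRange⇒0≤shorts r))
  λ ()

no-longs⇒∣V∣≡0 : ∀ n k → longs n k ≡ + 0 → ∣V Φ (n - + 3) (k - + 2) ∣ ≡ 0
no-longs⇒∣V∣≡0 n k l≡0 = ¬inRange⇒∣V∣≡0 (n - + 3) (k - + 2) λ r → contradiction
  (subst (0ℤ ≤_) (trans (longs-drop-011 n k) (cong (_- 1ℤ) l≡0)) (inRange⇒0≤longs r))
  λ ()

-- The vertex recurrence lowers either `a` or `b` by one, as Pascal's rule does. On the boundary one
-- of its two terms vanishes.
∣V∣≡[a+b]Ca : ∀ a b n k → shorts n k ≡ + a → longs n k ≡ + b → ∣V Φ n k ∣ ≡ (a ℕ.+ b) C a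
∣V∣≡[a+b]Ca zero zero n k s≡ l≡
  -- No blocks means `n = 1` and `k = 0`; the vertex list then evaluates to the single word 0.
  with refl ← n≡1+2a+3b {n} {k} s≡ l≡ | refl ← k≡a+2b {n} {k} s≡ l≡ = refl
∣V∣≡[a+b]Ca zero (suc b) n k s≡ l≡ = begin
  ∣V Φ n k ∣
    ≡⟨ ∣V∣-recurrence n k n≢1 ⟩
  ∣V Φ (n - + 2) (k - + 1) ∣ ℕ.+ ∣V Φ (n - + 3) (k - + 2) ∣
    ≡⟨ cong₂ ℕ._+_ (no-shorts⇒∣V∣≡0 n k s≡)
         (∣V∣≡[a+b]Ca zero b (n - + 3) (k - + 2) (trans (shorts-drop-011 n k) s≡)
           (trans (longs-drop-011 n k) (cong (_- 1ℤ) l≡))) ⟩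
  b C 0
    ≡⟨ trans (nC0≡1 b) (sym (nC0≡1 (suc b))) ⟩
  suc b C 0 ∎
  where
  open ≡-Reasoning
  n≢1 : n ≢ 1ℤ
  n≢1 n≡1 with () ← trans (sym n≡1) (n≡1+2a+3b {n} {k} s≡ l≡)
∣V∣≡[a+b]Ca (suc a) zero n k s≡ l≡ = begin
  ∣V Φ n k ∣
    ≡⟨ ∣V∣-recurrence n k n≢1 ⟩
  ∣V Φ (n - + 2) (k - + 1) ∣ ℕ.+ ∣V Φ (n - + 3) (k - + 2) ∣
    ≡⟨ cong₂ ℕ._+_
         (∣V∣≡[a+b]Ca a zero (n - + 2) (k - + 1) (trans (shorts-drop-01 n k) (cong (_- 1ℤ) s≡))
           (trans (longs-drop-01 n k) l≡))
         (no-longs⇒∣V∣≡0 n k l≡) ⟩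
  (a ℕ.+ 0) C a ℕ.+ 0
    ≡⟨ ℕ.+-identityʳ _ ⟩
  (a ℕ.+ 0) C a
    ≡⟨ cong (_C a) (ℕ.+-identityʳ a) ⟩
  a C a
    ≡⟨ trans (nCn≡1 a) (sym (nCn≡1 (suc a))) ⟩
  suc a C suc a
    ≡⟨ cong (λ m → suc m C suc a) (ℕ.+-identityʳ a) ⟨
  suc (a ℕ.+ 0) C suc a ∎
  where
  open ≡-Reasoning
  n≢1 : n ≢ 1ℤ
  n≢1 n≡1 with () ← trans (sym n≡1) (n≡1+2a+3b {n} {k} s≡ l≡)
∣V∣≡[a+b]Ca (suc a) (suc b) n k s≡ l≡ = begin
  ∣V Φ n k ∣
    ≡⟨ ∣V∣-recurrence n k n≢1 ⟩
  ∣V Φ (n - + 2) (k - + 1) ∣ ℕ.+ ∣V Φ (n - + 3) (k - + 2) ∣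
    ≡⟨ cong₂ ℕ._+_
         (∣V∣≡[a+b]Ca a (suc b) (n - + 2) (k - + 1) (trans (shorts-drop-01 n k) (cong (_- 1ℤ) s≡))
           (trans (longs-drop-01 n k) l≡))
         (∣V∣≡[a+b]Ca (suc a) b (n - + 3) (k - + 2) (trans (shorts-drop-011 n k) s≡)
           (trans (longs-drop-011 n k) (cong (_- 1ℤ) l≡))) ⟩
  (a ℕ.+ suc b) C a ℕ.+ suc (a ℕ.+ b) C suc a
    ≡⟨ cong (λ m → (a ℕ.+ suc b) C a ℕ.+ m C suc a) (ℕ.+-suc a b) ⟨
  (a ℕ.+ suc b) C a ℕ.+ (a ℕ.+ suc b) C suc a
    ≡⟨ nCk+nC[k+1]≡[n+1]C[k+1] (a ℕ.+ suc b) a ⟩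
  suc (a ℕ.+ suc b) C suc a ∎
  where
  open ≡-Reasoning
  n≢1 : n ≢ 1ℤ
  n≢1 n≡1 with () ← trans (sym n≡1) (n≡1+2a+3b {n} {k} s≡ l≡)

-- The upper index is the total number of blocks, `shorts n k + longs n k`. Both counts are
-- nonnegative in the range, so `_choose_` agrees with the natural binomial coefficient.
∣V∣≡choose : ∀ {n k} → InRange n k → ∣V Φ n k ∣ ≡ (n - k - + 1) choose (shorts n k)
∣V∣≡choose {n} {k} r = begin
  ∣V Φ n k ∣
    ≡⟨ ∣V∣≡[a+b]Ca a b n k (sym a≡) (sym b≡) ⟩
  (+ (a ℕ.+ b)) choose (+ a)
    ≡⟨ cong₂ _choose_ (trans (ℤ.pos-+ a b) (trans (cong₂ _+_ a≡ b≡) (blocks-total n k))) a≡ ⟩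
  (n - k - + 1) choose (shorts n k) ∎
  where
  open ≡-Reasoning
  a = ℤ.∣ shorts n k ∣
  b = ℤ.∣ longs n k ∣

  a≡ : + a ≡ shorts n k
  a≡ = ℤ.0≤i⇒+∣i∣≡i (inRange⇒0≤shorts r)

  b≡ : + b ≡ longs n k
  b≡ = ℤ.0≤i⇒+∣i∣≡i (inRange⇒0≤longs r)

  blocks-total : ∀ n k → (+ 2 * n - + 3 * k - + 2) + (+ 2 * k - n + 1ℤ) ≡ n - k - + 1
  blocks-total = solve-∀

proposition3p1 : (n k : ℤ) → 1ℤ ≤ n → n / + 2 ≤ k → k ≤ (+ 2 * n - + 2) / + 3 →
    (∣V Φ n k ∣ ≡ (n - k - + 1) choose (+ 2 * n - + 3 * k - + 2)) ×
    (∣E Φ n k ∣ ≡ ∣E Φ (n - + 2) (k - + 1) ∣ ℕ.+ ∣E Φ (n - + 3) (k - + 2) ∣ ℕ.+ ∣V Φ (n - + 5) (k - + 3) ∣)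
proposition3p1 n k 1≤n lower upper = ∣V∣≡choose (inRange 1≤n lower upper) , ∣E∣-recurrence n k
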